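{- There is no universal constant $c>0$ such that the myopic greedy algorithm satisfies $\mathbb E[\mathrm{Rev}^{\mathrm{Greedy}}]\ge c\,\mathrm{OPT}_{\mathrm{on}}$ for all instances of the online allocation model in the full-compatibility setting.
   Context: Model. An instance consists of products $\mathcal I=\{1,\dots,m\}$, capacities $b_i\in\mathbb Z_+$, base rewards $r_i\ge 0$, bonus functions $f_i:\mathbb Z_+\to\mathbb R_+$ that are nonnegative and nondecreasing with $f_i(0)=0$, a horizon of $T$ periods and arrival probabilities $p_1,\dots,p_T\in[0,1]$. In period $t$ a customer arrives with probability $p_t$, independently across periods. Each arriving customer must be immediately and irrevocably assigned to a product with remaining capacity or rejected; every customer may be assigned to every product (full compatibility). The $k$-th sale of product $i$ yields reward $r_i+f_i(k)$. An online algorithm $\pi$ knows all parameters of the instance, but its decision in each period depends only on the arrivals observed so far, its past decisions and internal randomization independent of the arrivals. $\mathrm{Rev}^\pi$ is its random total reward and $\mathrm{OPT}_{\mathrm{on}}=\sup_\pi\mathbb E[\mathrm{Rev}^\pi]$ over all online algorithms. Myopic greedy: given current allocation $\boldsymbol x$ ($x_j$ customers already assigned to product $j$), assign an arriving customer to some $i\in\arg\max_{j:\,x_j<b_j}\{r_j+f_j(x_j+1)\}$; if all products are sold out, reject the customer. -}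

module Defs where

open import Algebra.Bundles using (CommutativeRing; Semiring)
import Algebra.Definitions
import Algebra.Definitions.RawSemiring as RawSemiring
open import Data.Bool.Base using (Bool; true; false; if_then_else_)
open import Data.Fin.Base using (Fin)
import Data.Fin.Properties as Fin
open import Data.List.Base using (List; []; _∷_)
open import Data.Maybe.Base using (Maybe; just; nothing)
import Data.Nat.Base as ℕ
open ℕ using (ℕ; zero; suc)
open import Data.Product.Base using (∃; _×_; _,_)
open import Data.Vec.Base using (Vec; []; _∷_; lookup)
open import Level using (Lift; _⊔_) renaming (suc to lsuc)
open import Relation.Binary.Core using (Rel)
open import Relation.Binary.Structures using (IsTotalOrder)
open import Relation.Nullary.Decidable.Core using (does)
open import Relation.Nullary.Negation.Core using (¬_)

-- Rewards, probabilities and the constant c take values in an arbitrary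
-- (textbook, totally) ordered field, of which ℝ is the intended instance.
record OrderedField a ℓ₁ ℓ₂ : Set (lsuc (a ⊔ ℓ₁ ⊔ ℓ₂)) where
  infix 4 _≤_ _<_
  field
    commutativeRing : CommutativeRing a ℓ₁
  open CommutativeRing commutativeRing public
  open Algebra.Definitions _≈_ using (Invertible)
  field
    _≤_          : Rel Carrier ℓ₂
    isTotalOrder : IsTotalOrder _≈_ _≤_
    0#≉1#        : ¬ (0# ≈ 1#)
    invertible   : ∀ {x} → ¬ (x ≈ 0#) → Invertible 1# _*_ x
    +-monoʳ-≤    : ∀ z {x y} → x ≤ y → z + x ≤ z + y
    *-nonNeg     : ∀ {x y} → 0# ≤ x → 0# ≤ y → 0# ≤ x * y

  _<_ : Rel Carrier (ℓ₁ ⊔ ℓ₂)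
  x < y = x ≤ y × ¬ (x ≈ y)

module Allocation {a ℓ₁ ℓ₂} (K : OrderedField a ℓ₁ ℓ₂) where

  open OrderedField K
  open RawSemiring (Semiring.rawSemiring semiring) using (sum; product)

  IsSupremum : ∀ {i} {A : Set i} → (A → Carrier) → Carrier → Set (i ⊔ a ⊔ ℓ₂)
  IsSupremum g s = (∀ x → g x ≤ s) × (∀ u → (∀ x → g x ≤ u) → s ≤ u)

  record Instance : Set (a ⊔ ℓ₁ ⊔ ℓ₂) where
    field
      m        : ℕ
      b        : Fin m → ℕ
      r        : Fin m → Carrier
      f        : Fin m → ℕ → Carrier
      T        : ℕ
      p        : Fin T → Carrier
      r-nonNeg : ∀ i → 0# ≤ r i
      f-nonNeg : ∀ i k → 0# ≤ f i k
      f-mono   : ∀ i {k l} → k ℕ.≤ l → f i k ≤ f i l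
      f-zero   : ∀ i → f i 0 ≈ 0#
      p-nonNeg : ∀ t → 0# ≤ p t
      p≤1      : ∀ t → p t ≤ 1#

  module _ (I : Instance) where
    open Instance I

    data Event : Set where
      noArrival rejected : Event
      assigned           : Fin m → Event

    -- One event per elapsed period, most recent first.
    History : Set
    History = List Event

    sold : History → Fin m → ℕ
    sold []               j = 0
    sold (noArrival  ∷ h) j = sold h j
    sold (rejected   ∷ h) j = sold h j
    sold (assigned i ∷ h) j =
      if does (i Fin.≟ j) then suc (sold h j) else sold h j

    Available : History → Fin m → Set
    Available h i = sold h i ℕ.< b i

    saleReward : Fin m → ℕ → Carrier
    saleReward i k = r i + f i k

    totalReward : History → Carrier
    totalReward []               = 0#
    totalReward (noArrival  ∷ h) = totalReward h
    totalReward (rejected   ∷ h) = totalReward h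
    totalReward (assigned i ∷ h) = saleReward i (suc (sold h i)) + totalReward h

    -- What to do with a customer arriving after the history h;
    -- `nothing` means rejection.
    DecisionRule : Set
    DecisionRule = (h : History) → Maybe (∃ (Available h))

    -- The internal randomization is a random seed, drawn independently of the
    -- arrivals.  Finitely many seeds suffice, since only finitely many
    -- deterministic rules are distinguishable within T periods.
    record Policy : Set (a ⊔ ℓ₁ ⊔ ℓ₂) where
      field
        seeds         : ℕ
        weight        : Fin seeds → Carrier
        weight-nonNeg : ∀ s → 0# ≤ weight s
        weight-sum    : sum weight ≈ 1#
        decide        : Fin seeds → DecisionRule

    event : (h : History) → Maybe (∃ (Available h)) → Event
    event h nothing        = rejected
    event h (just (i , _)) = assigned i

    -- `true` at position t means that a customer arrives in period t.
    run : ∀ {n} → DecisionRule → Vec Bool n → History → History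
    run d []           h = h
    run d (false ∷ as) h = run d as (noArrival ∷ h)
    run d (true  ∷ as) h = run d as (event h (d h) ∷ h)

    Rev : DecisionRule → Vec Bool T → Carrier
    Rev d ω = totalReward (run d ω [])

    probability : Vec Bool T → Carrier
    probability ω = product (λ t → if lookup ω t then p t else 1# - p t)

    sumOutcomes : ∀ n → (Vec Bool n → Carrier) → Carrier
    sumOutcomes zero    g = g []
    sumOutcomes (suc n) g =
      sumOutcomes n (λ ω → g (true ∷ ω)) + sumOutcomes n (λ ω → g (false ∷ ω))

    expectedRev : Policy → Carrier
    expectedRev π =
      sum (λ s → weight s * sumOutcomes T (λ ω → probability ω * Rev (decide s) ω))
      where open Policy π

    IsOPTon : Carrier → Set (a ⊔ ℓ₁ ⊔ ℓ₂)
    IsOPTon = IsSupremum expectedRev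

    IsGreedyDecision : (h : History) → Maybe (∃ (Available h)) → Set ℓ₂
    IsGreedyDecision h (just (i , _)) = ∀ j → Available h j →
      saleReward j (suc (sold h j)) ≤ saleReward i (suc (sold h i))
    IsGreedyDecision h nothing        = Lift ℓ₂ (∀ j → ¬ Available h j)

    -- Ties in the argmax may be broken in any way, even at random.
    IsMyopicGreedy : Policy → Set ℓ₂
    IsMyopicGreedy π = ∀ s h → IsGreedyDecision h (Policy.decide π s h)

{-# OPTIONS --safe #-}
-- Take two periods with certain arrivals, a product "plain" with one unit and
-- constant reward 1, and a product "bonus" with two units whose first sale pays
-- nothing and whose second pays M ≥ 1.  Greedy sells plain first and so can only
-- make the worthless first sale of bonus: it earns 1, whereas the optimum is M.
-- With M = 1 + c⁻¹, the guarantee c * M ≤ 1 would give c ≤ 0.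
module Submission where

open import Defs
open import Algebra.Bundles using (Semiring)
import Algebra.Definitions.RawSemiring as RawSemiring
import Algebra.Properties.Ring as RingProperties
open import Data.Bool.Base using (Bool; true; false)
open import Data.Empty using (⊥-elim)
open import Data.Fin.Base using (Fin; zero; suc)
open import Data.List.Base using ([]; _∷_)
open import Data.Maybe.Base using (Maybe; just; nothing)
import Data.Nat.Base as ℕ
open ℕ using (ℕ; zero; suc; z≤n; s≤s)
import Data.Nat.Properties as ℕ
open import Data.Product.Base using (∃; _×_; _,_; proj₁; proj₂)
open import Data.Sum.Base using (inj₁; inj₂)
open import Data.Vec.Base using (Vec; []; _∷_)
open import Level using (lift)
open import Relation.Binary.Bundles using (Poset)
import Relation.Binary.Reasoning.PartialOrder as PosetReasoning
open import Relation.Binary.Structures using (IsTotalOrder)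
open import Relation.Nullary.Decidable.Core using (yes; no)
open import Relation.Nullary.Negation.Core using (¬_)

-- Order arithmetic in an ordered field.

module OrderedFieldProperties {a ℓ₁ ℓ₂} (K : OrderedField a ℓ₁ ℓ₂) where

  open OrderedField K hiding (zero)
  open RawSemiring (Semiring.rawSemiring semiring) using (sum)
  open RingProperties ring using (-‿distribʳ-*; -‿involutive)
  open IsTotalOrder isTotalOrder public using (total; antisym)
    renaming (refl to ≤-refl; reflexive to ≤-reflexive; trans to ≤-trans)

  ≤-poset : Poset a ℓ₁ ℓ₂
  ≤-poset = record { isPartialOrder = IsTotalOrder.isPartialOrder isTotalOrder }

  open PosetReasoning ≤-poset

  x≤y⇒0≤-x+y : ∀ {x y} → x ≤ y → 0# ≤ - x + y
  x≤y⇒0≤-x+y {x} {y} x≤y = begin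
    0#       ≈⟨ -‿inverseˡ x ⟨
    - x + x  ≤⟨ +-monoʳ-≤ (- x) x≤y ⟩
    - x + y  ∎

  x≤0⇒0≤-x : ∀ {x} → x ≤ 0# → 0# ≤ - x
  x≤0⇒0≤-x {x} x≤0 = begin
    0#        ≤⟨ x≤y⇒0≤-x+y x≤0 ⟩
    - x + 0#  ≈⟨ +-identityʳ (- x) ⟩
    - x       ∎

  x≤x+y : ∀ x {y} → 0# ≤ y → x ≤ x + y
  x≤x+y x {y} 0≤y = begin
    x       ≈⟨ +-identityʳ x ⟨
    x + 0#  ≤⟨ +-monoʳ-≤ x 0≤y ⟩
    x + y   ∎

  +-mono-≤ : ∀ {x y u v} → x ≤ y → u ≤ v → x + u ≤ y + v
  +-mono-≤ {x} {y} {u} {v} x≤y u≤v = begin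
    x + u  ≤⟨ +-monoʳ-≤ x u≤v ⟩
    x + v  ≈⟨ +-comm x v ⟩
    v + x  ≤⟨ +-monoʳ-≤ v x≤y ⟩
    v + y  ≈⟨ +-comm v y ⟩
    y + v  ∎

  -- The order axiom for products concerns nonnegative factors only, so `w * y` is split as `w * x`
  -- plus the nonnegative product `w * (- x + y)`.
  *-monoʳ-≤ : ∀ {w x y} → 0# ≤ w → x ≤ y → w * x ≤ w * y
  *-monoʳ-≤ {w} {x} {y} 0≤w x≤y = begin
    w * x                    ≤⟨ x≤x+y (w * x) (*-nonNeg 0≤w (x≤y⇒0≤-x+y x≤y)) ⟩
    w * x + w * (- x + y)    ≈⟨ distribˡ w x (- x + y) ⟨
    w * (x + (- x + y))      ≈⟨ *-congˡ (+-assoc x (- x) y) ⟨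
    w * (x + - x + y)        ≈⟨ *-congˡ (+-congʳ (-‿inverseʳ x)) ⟩
    w * (0# + y)             ≈⟨ *-congˡ (+-identityˡ y) ⟩
    w * y                    ∎

  -- If `1# ≤ 0#`, then `- 1#` is nonnegative, and so is its square, which is `1#`.
  0≤1 : 0# ≤ 1#
  0≤1 with total 0# 1#
  ... | inj₁ 0≤1 = 0≤1
  ... | inj₂ 1≤0 = begin
    0#             ≤⟨ *-nonNeg 0≤-1 0≤-1 ⟩
    - 1# * - 1#    ≈⟨ -‿distribʳ-* (- 1#) 1# ⟨
    - (- 1# * 1#)  ≈⟨ -‿cong (*-identityʳ (- 1#)) ⟩
    - - 1#         ≈⟨ -‿involutive 1# ⟩
    1#             ∎
    where 0≤-1 = x≤0⇒0≤-x 1≤0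

  1≰0 : ¬ (1# ≤ 0#)
  1≰0 1≤0 = 0#≉1# (antisym 0≤1 1≤0)

  -- If `y ≤ 0#`, multiplying by `x` would give `1# ≤ 0#`.
  inverse-nonNeg : ∀ {x y} → 0# ≤ x → x * y ≈ 1# → 0# ≤ y
  inverse-nonNeg {x} {y} 0≤x xy≈1 with total 0# y
  ... | inj₁ 0≤y = 0≤y
  ... | inj₂ y≤0 = ⊥-elim (1≰0 (begin
    1#      ≈⟨ xy≈1 ⟨
    x * y   ≤⟨ *-monoʳ-≤ 0≤x y≤0 ⟩
    x * 0#  ≈⟨ zeroʳ x ⟩
    0#      ∎))

  x+y≤y⇒x≤0 : ∀ {x y} → x + y ≤ y → x ≤ 0#
  x+y≤y⇒x≤0 {x} {y} x+y≤y = begin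
    x                ≈⟨ +-identityʳ x ⟨
    x + 0#           ≈⟨ +-congˡ (-‿inverseʳ y) ⟨
    x + (y + - y)    ≈⟨ +-assoc x y (- y) ⟨
    x + y + - y      ≤⟨ +-mono-≤ x+y≤y ≤-refl ⟩
    y + - y          ≈⟨ -‿inverseʳ y ⟩
    0#               ∎

  -- For weights of total 1 this says that randomizing over seeds cannot exceed a bound that every
  -- seed respects.
  sum-weighted-≤ : ∀ {n v} (w g : Fin n → Carrier) → (∀ s → 0# ≤ w s) →
                   (∀ s → g s ≤ v) → sum (λ s → w s * g s) ≤ sum w * v
  sum-weighted-≤ {zero}  {v} w g 0≤w g≤v = ≤-reflexive (sym (zeroˡ v))
  sum-weighted-≤ {suc n} {v} w g 0≤w g≤v = begin
    w zero * g zero + sum (λ s → w (suc s) * g (suc s))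
      ≤⟨ +-mono-≤ (*-monoʳ-≤ (0≤w zero) (g≤v zero))
                  (sum-weighted-≤ (λ s → w (suc s)) (λ s → g (suc s))
                                  (λ s → 0≤w (suc s)) (λ s → g≤v (suc s))) ⟩
    w zero * v + sum (λ s → w (suc s)) * v
      ≈⟨ distribʳ v (w zero) (sum (λ s → w (suc s))) ⟨
    sum w * v ∎

-- The two-period instance, its optimum and its greedy revenue.

module TwoPeriods {a ℓ₁ ℓ₂} (K : OrderedField a ℓ₁ ℓ₂)
                  (M : OrderedField.Carrier K)
                  (1≤M : OrderedField._≤_ K (OrderedField.1# K) M) where

  open OrderedField K hiding (zero)
  open Allocation K
  open OrderedFieldProperties K
  open PosetReasoning ≤-poset

  pattern plain = zero
  pattern bonus = suc zero

  0≤M : 0# ≤ M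
  0≤M = ≤-trans 0≤1 1≤M

  instance₂ : Instance
  instance₂ = record
    { m        = 2
    ; b        = capacity
    ; r        = base
    ; f        = extra
    ; T        = 2
    ; p        = λ _ → 1#
    ; r-nonNeg = λ { plain → 0≤1 ; bonus → ≤-refl }
    ; f-nonNeg = extra-nonNeg
    ; f-mono   = extra-mono
    ; f-zero   = λ { plain → refl ; bonus → refl }
    ; p-nonNeg = λ _ → 0≤1
    ; p≤1      = λ _ → ≤-refl
    }
    where
    capacity : Fin 2 → ℕ
    capacity plain = 1
    capacity bonus = 2

    base : Fin 2 → Carrier
    base plain = 1#
    base bonus = 0#

    extra : Fin 2 → ℕ → Carrier
    extra plain _             = 0#
    extra bonus zero          = 0#
    extra bonus (suc zero)    = 0#
    extra bonus (suc (suc _)) = M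

    extra-nonNeg : ∀ i k → 0# ≤ extra i k
    extra-nonNeg plain _             = ≤-refl
    extra-nonNeg bonus zero          = ≤-refl
    extra-nonNeg bonus (suc zero)    = ≤-refl
    extra-nonNeg bonus (suc (suc _)) = 0≤M

    extra-mono : ∀ i {k l} → k ℕ.≤ l → extra i k ≤ extra i l
    extra-mono plain _                      = ≤-refl
    -- The bonus is still zero at `k = 0` and `k = 1`, so there monotonicity amounts to
    -- nonnegativity at `l`.
    extra-mono bonus {l = l} z≤n            = extra-nonNeg bonus l
    extra-mono bonus {l = l} (s≤s z≤n)      = extra-nonNeg bonus l
    extra-mono bonus (s≤s (s≤s _))          = ≤-refl

  -- The arguments are in chronological order, whereas a history lists the latest event first.
  earned : Event instance₂ → Event instance₂ → Carrier
  earned e₁ e₂ = totalReward instance₂ (e₂ ∷ e₁ ∷ [])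

  -- This is the shape of `totalReward` after a first sale of `bonus`: base reward plus extra,
  -- followed by the reward `x` collected earlier.
  0+[0+x]≈x : ∀ x → (0# + 0#) + x ≈ x
  0+[0+x]≈x x = trans (+-congʳ (+-identityˡ 0#)) (+-identityˡ x)

  0+0+0≈0 : (0# + 0#) + 0# ≈ 0#
  0+0+0≈0 = 0+[0+x]≈x 0#

  1+0+0≈1 : (1# + 0#) + 0# ≈ 1#
  1+0+0≈1 = trans (+-identityʳ (1# + 0#)) (+-identityʳ 1#)

  earned-bonus-bonus : earned (assigned bonus) (assigned bonus) ≈ M
  earned-bonus-bonus = trans (+-cong (+-identityˡ M) 0+0+0≈0) (+-identityʳ M)

  earned-plain-bonus : earned (assigned plain) (assigned bonus) ≈ 1#
  earned-plain-bonus = trans (0+[0+x]≈x _) 1+0+0≈1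

  Decision : History instance₂ → Set
  Decision h = Maybe (∃ (Available instance₂ h))

  -- Only two sales of `bonus` pay `M`; every other feasible pair of events earns 0 or 1.
  earned≤M : (d₁ : Decision []) (let e₁ = event instance₂ [] d₁)
             (d₂ : Decision (e₁ ∷ [])) →
             earned e₁ (event instance₂ (e₁ ∷ []) d₂) ≤ M
  earned≤M nothing            nothing            = 0≤M
  earned≤M nothing            (just (plain , _)) = ≤-trans (≤-reflexive 1+0+0≈1) 1≤M
  earned≤M nothing            (just (bonus , _)) = ≤-trans (≤-reflexive 0+0+0≈0) 0≤M
  earned≤M (just (plain , _)) nothing            = ≤-trans (≤-reflexive 1+0+0≈1) 1≤M
  -- The single unit of `plain` is gone after the first period.
  earned≤M (just (plain , _)) (just (plain , s≤s ()))
  earned≤M (just (plain , _)) (just (bonus , _)) =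
    ≤-trans (≤-reflexive earned-plain-bonus) 1≤M
  earned≤M (just (bonus , _)) nothing            = ≤-trans (≤-reflexive 0+0+0≈0) 0≤M
  earned≤M (just (bonus , _)) (just (plain , _)) =
    ≤-trans (≤-reflexive (trans (+-cong (+-identityʳ 1#) 0+0+0≈0) (+-identityʳ 1#))) 1≤M
  earned≤M (just (bonus , _)) (just (bonus , _)) = ≤-reflexive earned-bonus-bonus

  -- Both products start out available and a first sale of `bonus` pays nothing, so the first
  -- decision must be `plain`. The second period can then add at most a worthless first sale of
  -- `bonus`.
  greedy-earned≤1 : (d₁ : Decision []) → IsGreedyDecision instance₂ [] d₁ →
                    (let e₁ = event instance₂ [] d₁) (d₂ : Decision (e₁ ∷ [])) →
                    earned e₁ (event instance₂ (e₁ ∷ []) d₂) ≤ 1#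
  greedy-earned≤1 nothing            (lift none) _ = ⊥-elim (none plain (s≤s z≤n))
  greedy-earned≤1 (just (bonus , _)) best        _ = ⊥-elim (1≰0 (begin
    1#       ≈⟨ +-identityʳ 1# ⟨
    1# + 0#  ≤⟨ best plain (s≤s z≤n) ⟩
    0# + 0#  ≈⟨ +-identityʳ 0# ⟩
    0#       ∎))
  greedy-earned≤1 (just (plain , _)) _ nothing                  = ≤-reflexive 1+0+0≈1
  greedy-earned≤1 (just (plain , _)) _ (just (plain , s≤s ()))
  greedy-earned≤1 (just (plain , _)) _ (just (bonus , _))       =
    ≤-reflexive earned-plain-bonus

  -- Every outcome with a missing arrival carries a factor `1# - 1#`, so its term vanishes.
  sumOutcomes-certain : (g : Vec Bool 2 → Carrier) →
                        sumOutcomes instance₂ 2 (λ ω → probability instance₂ ω * g ω)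
                        ≈ g (true ∷ true ∷ [])
  sumOutcomes-certain g =
    -- The four terms come in the order true-true, true-false, false-true, false-false; in the
    -- second, the vanishing factor sits behind a leading `1#`.
    trans (+-cong (+-cong present (absent (trans (*-identityˡ _) no-arrival)))
                  (+-cong (absent no-arrival) (absent no-arrival)))
    (trans (+-cong (+-identityʳ _) (+-identityʳ 0#)) (+-identityʳ _))
    where
    present : ∀ {x} → (1# * (1# * 1#)) * x ≈ x
    present = trans (*-congʳ (trans (*-identityˡ _) (*-identityˡ 1#))) (*-identityˡ _)

    no-arrival : ∀ {x} → (1# - 1#) * x ≈ 0#
    no-arrival = trans (*-congʳ (-‿inverseʳ 1#)) (zeroˡ _)

    absent : ∀ {q x} → q ≈ 0# → q * x ≈ 0#
    absent q≈0 = trans (*-congʳ q≈0) (zeroˡ _)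

  Rev₂ : DecisionRule instance₂ → Carrier
  Rev₂ d = Rev instance₂ d (true ∷ true ∷ [])

  -- Reduces bounds for randomized policies to deterministic rules on the one outcome of positive
  -- probability.
  expectedRev≤ : (π : Policy instance₂) → ∀ {v} →
                 (∀ s → Rev₂ (Policy.decide π s) ≤ v) → expectedRev instance₂ π ≤ v
  expectedRev≤ π {v} bound = begin
    expectedRev instance₂ π
      ≤⟨ sum-weighted-≤ weight _ weight-nonNeg (λ s →
           ≤-trans (≤-reflexive (sumOutcomes-certain (Rev instance₂ (decide s)))) (bound s)) ⟩
    sum weight * v  ≈⟨ *-congʳ weight-sum ⟩
    1# * v          ≈⟨ *-identityˡ v ⟩
    v               ∎
    where
    open Policy π
    open RawSemiring (Semiring.rawSemiring semiring) using (sum)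

  bonus-only : Policy instance₂
  bonus-only = record
    { seeds         = 1
    ; weight        = λ _ → 1#
    ; weight-nonNeg = λ _ → 0≤1
    ; weight-sum    = +-identityʳ 1#
    ; decide        = λ _ → rule
    }
    where
    rule : DecisionRule instance₂
    -- A rule must answer every history, including those in which `bonus` is sold out.
    rule h with sold instance₂ h bonus ℕ.<? 2
    ... | yes available = just (bonus , available)
    ... | no  _         = nothing

  expectedRev-bonus-only : expectedRev instance₂ bonus-only ≈ M
  expectedRev-bonus-only =
    trans (+-identityʳ _) (trans (*-identityˡ _)
      -- On the concrete histories of this run the capacity test computes to `yes`, so the revenue
      -- unfolds to that of two `bonus` sales.
      (trans (sumOutcomes-certain (Rev instance₂ (decide zero))) earned-bonus-bonus))
    where open Policy bonus-only

  -- The supremum is attained by `bonus-only`, so any upper bound is at least `M`.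
  M-isOPTon : IsOPTon instance₂ M
  M-isOPTon =
      (λ π → expectedRev≤ π (λ s → let d = Policy.decide π s in
        earned≤M (d []) (d (event instance₂ [] (d []) ∷ []))))
    , (λ u bound → ≤-trans (≤-reflexive (sym expectedRev-bonus-only)) (bound bonus-only))

  greedy-expectedRev≤1 : (π : Policy instance₂) → IsMyopicGreedy instance₂ π →
                         expectedRev instance₂ π ≤ 1#
  greedy-expectedRev≤1 π isGreedy = expectedRev≤ π λ s →
    let d = Policy.decide π s in
    greedy-earned≤1 (d []) (isGreedy s []) (d (event instance₂ [] (d []) ∷ []))

-- Refuting a constant-factor guarantee.

proposition1 : ∀ {a ℓ₁ ℓ₂} (K : OrderedField a ℓ₁ ℓ₂) →
    let open OrderedField K
        open Allocation K
    in (greedy : ∀ I → Policy I) → (∀ I → IsMyopicGreedy I (greedy I)) →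
       ¬ (∃ λ c → 0# < c × (∀ I V → IsOPTon I V → c * V ≤ expectedRev I (greedy I)))
proposition1 K greedy isGreedy (c , (0≤c , 0≉c) , guarantee) =
  0≉c (antisym 0≤c (x+y≤y⇒x≤0 c+1≤1))
  where
  open OrderedField K
  open Allocation K
  open OrderedFieldProperties K
  open PosetReasoning ≤-poset

  c-invertible = invertible (λ c≈0 → 0≉c (sym c≈0))

  c⁻¹ : Carrier
  c⁻¹ = proj₁ c-invertible

  c*c⁻¹≈1 : c * c⁻¹ ≈ 1#
  c*c⁻¹≈1 = proj₂ (proj₂ c-invertible)

  -- The summand `1#` secures the required lower bound on `M`, and `c⁻¹` turns `c * M` into
  -- `c + 1#`.
  open TwoPeriods K (1# + c⁻¹) (x≤x+y 1# (inverse-nonNeg 0≤c c*c⁻¹≈1))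

  c+1≤1 : c + 1# ≤ 1#
  c+1≤1 = begin
    c + 1#                                  ≈⟨ +-cong (*-identityʳ c) c*c⁻¹≈1 ⟨
    c * 1# + c * c⁻¹                        ≈⟨ distribˡ c 1# c⁻¹ ⟨
    c * (1# + c⁻¹)                          ≤⟨ guarantee instance₂ _ M-isOPTon ⟩
    expectedRev instance₂ (greedy instance₂)
      ≤⟨ greedy-expectedRev≤1 (greedy instance₂) (isGreedy instance₂) ⟩
    1#                                      ∎
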